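{- Let $M$ be a quaternary matroid on ground set $V$, and let $B$ be any representation of $M$ over $\mathrm{GF}(4)$. Then for every $Y\subseteq V$, the matroid $M(\mathrm{BC}_{\ker(B)}(Y))$ equals the matroid $\max(M+Y)$.
   Context: A representation of $M$ over $\mathrm{GF}(4)$ is a matrix $B$ over $\mathrm{GF}(4)$ with columns indexed by $V$ whose column matroid is $M$; $\ker(B)=\{v\in\mathrm{GF}(4)^V: Bv=0\}$. $\mathrm{inv}$ is the nontrivial automorphism $x\mapsto x^2$ of $\mathrm{GF}(4)$, applied entrywise to vectors and subspaces. For a subspace $L\subseteq\mathrm{GF}(4)^V$: $L^\perp=\{v:\sum_{x\in V}u(x)v(x)=0\ \forall u\in L\}$; $\pi_Y(v)$ sets the entries of $v$ outside $Y$ to $0$; $\mathrm{BC}_L(Y)=\{v\in L\mid \pi_Y(v)\in\mathrm{inv}(L^\perp)\}$; $M(L)$ is the matroid on $V$ whose circuits are the inclusion-minimal nonempty sets $C\subseteq V$ that are supports of vectors in $L$. Matroids are identified with the set system $(V,\mathcal{B})$ of their bases. For a set system $N=(V,D)$ and $Y\subseteq V$, the loop complementation $N+Y=(V,D')$ where $Z\in D'$ iff the number of $W\in D$ with $Z\setminus Y\subseteq W\subseteq Z$ is odd; $\max(N)=(V,\text{inclusion-maximal members of }D)$, here a matroid given by its bases. -}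

module Defs where

open import Data.Bool using (Bool; true; false; _∧_; _∨_; not; if_then_else_)
open import Data.Nat using (ℕ; zero; suc)
open import Data.List using (List; []; _∷_; map; concatMap; foldr)
open import Data.Bool.ListAction using (all; any)
open import Data.Vec using (Vec; []; _∷_; zipWith) renaming (map to vmap; foldr′ to vfoldr)

-- The field GF(4) = {0, 1, ω, ω²} with ω² = ω + 1.

data GF4 : Set where
  O I W W2 : GF4

_+F_ : GF4 → GF4 → GF4
O  +F y  = y
x  +F O  = x
I  +F I  = O
I  +F W  = W2
I  +F W2 = W
W  +F I  = W2
W  +F W  = O
W  +F W2 = I
W2 +F I  = W
W2 +F W  = I
W2 +F W2 = O

_*F_ : GF4 → GF4 → GF4
O  *F y  = O
x  *F O  = O
I  *F y  = y
x  *F I  = x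
W  *F W  = W2
W  *F W2 = I
W2 *F W  = I
W2 *F W2 = W

_=F_ : GF4 → GF4 → Bool
O  =F O  = true
I  =F I  = true
W  =F W  = true
W2 =F W2 = true
_  =F _  = false

isZeroF : GF4 → Bool
isZeroF x = x =F O

-- the nontrivial automorphism x ↦ x²
invF : GF4 → GF4
invF x = x *F x

allGF4 : List GF4
allGF4 = O ∷ I ∷ W ∷ W2 ∷ []

-- Finite enumeration of vectors.  The ground set V is Fin n;
-- vectors in GF(4)^V are Vec GF4 n, subsets of V are Vec Bool n.

allVecs : {A : Set} → List A → (n : ℕ) → List (Vec A n)
allVecs xs zero    = [] ∷ []
allVecs xs (suc n) = concatMap (λ x → map (x ∷_) (allVecs xs n)) xs

Subset : ℕ → Set
Subset n = Vec Bool n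

allSubsets : (n : ℕ) → List (Subset n)
allSubsets = allVecs (false ∷ true ∷ [])

Vect : ℕ → Set
Vect n = Vec GF4 n

allVects : (n : ℕ) → List (Vect n)
allVects = allVecs allGF4

andV : ∀ {n} → Vec Bool n → Bool
andV = vfoldr _∧_ true

orV : ∀ {n} → Vec Bool n → Bool
orV = vfoldr _∨_ false

eqVect : ∀ {n} → Vect n → Vect n → Bool
eqVect u v = andV (zipWith _=F_ u v)

_⇒B_ : Bool → Bool → Bool
a ⇒B b = not a ∨ b

_=B_ : Bool → Bool → Bool
true  =B b = b
false =B b = not b

eqSub : ∀ {n} → Subset n → Subset n → Bool
eqSub X Y = andV (zipWith _=B_ X Y)

_⊆B_ : ∀ {n} → Subset n → Subset n → Bool
X ⊆B Y = andV (zipWith _⇒B_ X Y)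

_∖B_ : ∀ {n} → Subset n → Subset n → Subset n
X ∖B Y = zipWith (λ a b → a ∧ not b) X Y

nonempty : ∀ {n} → Subset n → Bool
nonempty = orV

zeroVect : ∀ {n} → Vect n → Bool
zeroVect v = andV (vmap isZeroF v)

support : ∀ {n} → Vect n → Subset n
support v = vmap (λ x → not (isZeroF x)) v

dot : ∀ {n} → Vect n → Vect n → GF4
dot u v = vfoldr _+F_ O (zipWith _*F_ u v)

-- a subspace (or any subset) of GF(4)^V, given by its membership test
VSet : ℕ → Set
VSet n = Vect n → Bool

Matrix : ℕ → ℕ → Set
Matrix m n = Vec (Vect n) m

ker : ∀ {m n} → Matrix m n → VSet n
ker B v = andV (vmap (λ row → isZeroF (dot row v)) B)

perp : ∀ {n} → VSet n → VSet n
perp {n} L v = all (λ u → L u ⇒B isZeroF (dot u v)) (allVects n)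

invV : ∀ {n} → Vect n → Vect n
invV = vmap invF

invS : ∀ {n} → VSet n → VSet n
invS {n} S v = any (λ s → S s ∧ eqVect (invV s) v) (allVects n)

proj : ∀ {n} → Subset n → Vect n → Vect n
proj Y v = zipWith (λ b x → if b then x else O) Y v

BC : ∀ {n} → VSet n → Subset n → VSet n
BC L Y v = L v ∧ invS (perp L) (proj Y v)

-- Set systems (V, D) with D given by a membership test; matroids are
-- identified with their set system of bases.

SetSystem : ℕ → Set
SetSystem n = Subset n → Bool

maximalB : ∀ {n} → (Subset n → Bool) → Subset n → Bool
maximalB {n} P X = P X ∧ all (λ Z → (P Z ∧ (X ⊆B Z)) ⇒B eqSub Z X) (allSubsets n)

isSupportIn : ∀ {n} → VSet n → Subset n → Bool
isSupportIn {n} L C = any (λ v → L v ∧ eqSub (support v) C) (allVects n)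

circuitML : ∀ {n} → VSet n → Subset n → Bool
circuitML {n} L C =
  nonempty C ∧ isSupportIn L C ∧
  not (any (λ C' → nonempty C' ∧ (C' ⊆B C) ∧ not (eqSub C' C) ∧ isSupportIn L C')
           (allSubsets n))

indepML : ∀ {n} → VSet n → Subset n → Bool
indepML {n} L X = not (any (λ C → circuitML L C ∧ (C ⊆B X)) (allSubsets n))

basesML : ∀ {n} → VSet n → SetSystem n
basesML L = maximalB (indepML L)

-- Column matroid of B: X independent iff the columns indexed by X are
-- linearly independent, i.e. every coefficient vector c supported in X
-- with B c = 0 is zero.  Bases are the maximal independent sets.
indepCol : ∀ {m n} → Matrix m n → Subset n → Bool
indepCol {m} {n} B X =
  all (λ c → ((support c ⊆B X) ∧ ker B c) ⇒B zeroVect c) (allVects n)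

basesCol : ∀ {m n} → Matrix m n → SetSystem n
basesCol B = maximalB (indepCol B)

oddN : ℕ → Bool
oddN zero    = false
oddN (suc k) = not (oddN k)

countB : {A : Set} → (A → Bool) → List A → ℕ
countB p = foldr (λ x k → if p x then suc k else k) zero

loopCompl : ∀ {n} → SetSystem n → Subset n → SetSystem n
loopCompl {n} D Y Z =
  oddN (countB (λ W → ((Z ∖B Y) ⊆B W) ∧ (W ⊆B Z) ∧ D W) (allSubsets n))

maxSS : ∀ {n} → SetSystem n → SetSystem n
maxSS D = maximalB D

{-# OPTIONS --safe #-}

-- Let L = ker B and let h_Y(u , v) = Σ_{y ∈ Y} u(y) inv(v(y)), a Hermitian form
-- on L whose radical is R = BC_L(Y).  Call Z admissible if L projects onto the
-- coordinates outside Z and h_Y is nondegenerate on the vectors of L supported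
-- in Z.  For Y = ∅ the admissible sets are the bases of M.  Adding i to Y adds
-- the rank-one form u(i) inv(v(i)), and comparing with the hyperplane v(i) = 0
-- shows that admissibility obeys the same parity recursion in Y as loop
-- complementation; hence the members of M + Y are exactly the admissible sets.
-- An admissible set is independent in M(R).  Conversely, if Z is a basis of
-- M(R), then R projects isomorphically onto the coordinates outside Z, so
-- L = R ⊕ L_Z and Z is admissible.  So both sides have the same maximal sets.
module Submission where

open import Defs
open import Data.Bool using (Bool; true; false; T; _∧_; not; if_then_else_; _xor_)
open import Data.Bool.ListAction using (all; any)
open import Data.Bool.Properties using (not-distribˡ-xor; xor-identityʳ; ∧-zeroʳ; T-≡)
import Data.Bool.Properties as Bool
open import Data.Empty using (⊥-elim)
open import Data.Fin using (Fin; zero; suc)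
import Data.Fin.Properties as Fin
import Data.Fin.Subset as S
open import Data.Fin.Subset.Induction using (⊂-wellFounded; ⊃-wellFounded; Acc; acc)
open import Data.List using (List; []; _∷_; map; _++_)
open import Data.List.Membership.Propositional using (_∈_; lose; find)
open import Data.List.Membership.Propositional.Properties using (∈-map⁺; ∈-concatMap⁺)
import Data.List.Relation.Unary.All as All
import Data.List.Relation.Unary.All.Properties as All
open import Data.List.Relation.Unary.Any using (here; there)
import Data.List.Relation.Unary.Any.Properties as Any
open import Data.Nat using (ℕ; zero; suc)
open import Data.Product using (∃; _×_; _,_; proj₁; proj₂)
open import Data.Sum using (_⊎_; inj₁; inj₂)
open import Data.Vec using (Vec; []; _∷_; lookup; zipWith; replicate; _[_]≔_) renaming (map to vmap)
open import Data.Vec.Properties using (lookup-map; lookup-zipWith; lookup-replicate; lookup∘update; lookup∘update′; lookup⇒[]=; []=⇒lookup)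
open import Data.Vec.Relation.Binary.Pointwise.Extensional using (ext; Pointwise-≡⇒≡)
open import Function using (_∘_; id)
open import Function.Bundles using (_⇔_; mk⇔; Equivalence)
open import Relation.Binary.PropositionalEquality using (_≡_; _≢_; refl; sym; trans; cong; cong₂; subst)
open import Relation.Nullary using (¬_; Dec; yes; no; does; proof; _because_; contradiction)
open import Relation.Nullary.Decidable using (_×-dec_; _→-dec_; ¬?; T?; from-yes; decidable-stable)
open import Relation.Nullary.Reflects using (Reflects; ofʸ; ofⁿ; det; fromEquivalence; T-reflects; ¬-reflects; _×-reflects_; _→-reflects_)

open Equivalence using (to; from)

-- Reflection of the Boolean definitions

reflects-map : {P Q : Set} {b : Bool} → P ⇔ Q → Reflects P b → Reflects Q b
reflects-map e (ofʸ p)  = ofʸ (to e p)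
reflects-map e (ofⁿ ¬p) = ofⁿ (¬p ∘ from e)

reflects-to : {P : Set} {b : Bool} → Reflects P b → T b → P
reflects-to (ofʸ p) _ = p

reflects-from : {P : Set} {b : Bool} → Reflects P b → P → T b
reflects-from (ofʸ _)  _ = _
reflects-from (ofⁿ ¬p) p = ¬p p

allVecs-complete : {A : Set} {xs : List A} → (∀ x → x ∈ xs) → ∀ {n} (v : Vec A n) → v ∈ allVecs xs n
allVecs-complete c []      = here refl
allVecs-complete c (x ∷ v) = ∈-concatMap⁺ _ (lose (c x) (∈-map⁺ (x ∷_) (allVecs-complete c v)))

module _ {A : Set} {xs : List A} (complete : ∀ x → x ∈ xs) {P : A → Set} {p : A → Bool}
         (r : ∀ x → Reflects (P x) (p x)) where

  all-reflects : Reflects (∀ x → P x) (all p xs)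
  all-reflects = fromEquivalence
    (λ t x → reflects-to (r x) (All.lookup (All.all⁺ p xs t) (complete x)))
    (λ h → All.all⁻ p (All.universal (λ x → reflects-from (r x) (h x)) xs))

  any-reflects : Reflects (∃ P) (any p xs)
  any-reflects = fromEquivalence
    (λ t → let x , _ , px = find (Any.any⁻ p xs t) in x , reflects-to (r x) px)
    (λ (x , Px) → Any.any⁺ p (lose (complete x) (reflects-from (r x) Px)))

andV-reflects : {A : Set} {P : A → Set} {p : A → Bool} → (∀ x → Reflects (P x) (p x)) →
  ∀ {n} (v : Vec A n) → Reflects (∀ i → P (lookup v i)) (andV (vmap p v))
andV-reflects r []      = ofʸ λ ()
andV-reflects r (x ∷ v) = reflects-map
  (mk⇔ (λ { (p , ps) zero → p ; (p , ps) (suc i) → ps i }) (λ h → h zero , h ∘ suc))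
  (r x ×-reflects andV-reflects r v)

andV-zip-reflects : {A : Set} {P : A → A → Set} {p : A → A → Bool} → (∀ x y → Reflects (P x y) (p x y)) →
  ∀ {n} (u v : Vec A n) → Reflects (∀ i → P (lookup u i) (lookup v i)) (andV (zipWith p u v))
andV-zip-reflects r []      []      = ofʸ λ ()
andV-zip-reflects r (x ∷ u) (y ∷ v) = reflects-map
  (mk⇔ (λ { (p , ps) zero → p ; (p , ps) (suc i) → ps i }) (λ h → h zero , h ∘ suc))
  (r x y ×-reflects andV-zip-reflects r u v)

vec-ext : {A : Set} {n : ℕ} {u v : Vec A n} → (∀ i → lookup u i ≡ lookup v i) → u ≡ v
vec-ext h = Pointwise-≡⇒≡ (ext h)

vec-ext-⇔ : {A : Set} {n : ℕ} {u v : Vec A n} → (∀ i → lookup u i ≡ lookup v i) ⇔ (u ≡ v)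
vec-ext-⇔ = mk⇔ vec-ext λ { refl i → refl }

=F-reflects : ∀ x y → Reflects (x ≡ y) (x =F y)
=F-reflects O  O  = ofʸ refl
=F-reflects O  I  = ofⁿ λ ()
=F-reflects O  W  = ofⁿ λ ()
=F-reflects O  W2 = ofⁿ λ ()
=F-reflects I  O  = ofⁿ λ ()
=F-reflects I  I  = ofʸ refl
=F-reflects I  W  = ofⁿ λ ()
=F-reflects I  W2 = ofⁿ λ ()
=F-reflects W  O  = ofⁿ λ ()
=F-reflects W  I  = ofⁿ λ ()
=F-reflects W  W  = ofʸ refl
=F-reflects W  W2 = ofⁿ λ ()
=F-reflects W2 O  = ofⁿ λ ()
=F-reflects W2 I  = ofⁿ λ ()
=F-reflects W2 W  = ofⁿ λ ()
=F-reflects W2 W2 = ofʸ refl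

=B-reflects : ∀ x y → Reflects (x ≡ y) (x =B y)
=B-reflects true  true  = ofʸ refl
=B-reflects true  false = ofⁿ λ ()
=B-reflects false true  = ofⁿ λ ()
=B-reflects false false = ofʸ refl

_≟F_ : (x y : GF4) → Dec (x ≡ y)
x ≟F y = (x =F y) because =F-reflects x y

eqVect-reflects : ∀ {n} (u v : Vect n) → Reflects (u ≡ v) (eqVect u v)
eqVect-reflects u v = reflects-map vec-ext-⇔ (andV-zip-reflects =F-reflects u v)

eqSub-reflects : ∀ {n} (X Y : Subset n) → Reflects (X ≡ Y) (eqSub X Y)
eqSub-reflects X Y = reflects-map vec-ext-⇔ (andV-zip-reflects =B-reflects X Y)

_≟V_ : ∀ {n} (u v : Vect n) → Dec (u ≡ v)
u ≟V v = eqVect u v because eqVect-reflects u v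

∈-allGF4 : ∀ x → x ∈ allGF4
∈-allGF4 O  = here refl
∈-allGF4 I  = there (here refl)
∈-allGF4 W  = there (there (here refl))
∈-allGF4 W2 = there (there (there (here refl)))

∈-allVects : ∀ {n} (v : Vect n) → v ∈ allVects n
∈-allVects = allVecs-complete ∈-allGF4

∈-allSubsets : ∀ {n} (X : Subset n) → X ∈ allSubsets n
∈-allSubsets = allVecs-complete λ { false → here refl ; true → there (here refl) }

-- Universal statements over GF(4) are decided by running through its four elements, so the field
-- identities below are proved by evaluation through `from-yes`.
∀F? : {P : GF4 → Set} → (∀ x → Dec (P x)) → Dec (∀ x → P x)
∀F? P? = _ because all-reflects ∈-allGF4 (proof ∘ P?)

∀V? : ∀ {n} {P : Vect n → Set} → (∀ v → Dec (P v)) → Dec (∀ v → P v)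
∀V? P? = _ because all-reflects ∈-allVects (proof ∘ P?)

∃V? : ∀ {n} {P : Vect n → Set} → (∀ v → Dec (P v)) → Dec (∃ P)
∃V? P? = _ because any-reflects ∈-allVects (proof ∘ P?)

-- Arithmetic of GF(4) and the Hermitian form

I≢O : I ≢ O
I≢O ()

+F-self : ∀ x → x +F x ≡ O
+F-self = from-yes (∀F? λ x → (x +F x) ≟F O)

+F-identityʳ : ∀ x → x +F O ≡ x
+F-identityʳ = from-yes (∀F? λ x → (x +F O) ≟F x)

*F-zeroʳ : ∀ x → x *F O ≡ O
*F-zeroʳ = from-yes (∀F? λ x → (x *F O) ≟F O)

*F-identityʳ : ∀ x → x *F I ≡ x
*F-identityʳ = from-yes (∀F? λ x → (x *F I) ≟F x)

*F-comm : ∀ x y → x *F y ≡ y *F x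
*F-comm = from-yes (∀F? λ x → ∀F? λ y → (x *F y) ≟F (y *F x))

+F-cancel : ∀ x y → x +F y ≡ O → x ≡ y
+F-cancel = from-yes (∀F? λ x → ∀F? λ y → ((x +F y) ≟F O) →-dec (x ≟F y))

+F-swap : ∀ x y → x +F (y +F x) ≡ y
+F-swap = from-yes (∀F? λ x → ∀F? λ y → (x +F (y +F x)) ≟F y)

*F-integral : ∀ x y → y ≢ O → x *F y ≡ O → x ≡ O
*F-integral = from-yes (∀F? λ x → ∀F? λ y → (¬? (y ≟F O)) →-dec (((x *F y) ≟F O) →-dec (x ≟F O)))

invF-inverse : ∀ x → x ≢ O → invF x *F x ≡ I
invF-inverse = from-yes (∀F? λ x → (¬? (x ≟F O)) →-dec ((invF x *F x) ≟F I))

invF-involutive : ∀ x → invF (invF x) ≡ x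
invF-involutive = from-yes (∀F? λ x → invF (invF x) ≟F x)

invF-+ : ∀ x y → invF (x +F y) ≡ invF x +F invF y
invF-+ = from-yes (∀F? λ x → ∀F? λ y → invF (x +F y) ≟F (invF x +F invF y))

invF-* : ∀ x y → invF (x *F y) ≡ invF x *F invF y
invF-* = from-yes (∀F? λ x → ∀F? λ y → invF (x *F y) ≟F (invF x *F invF y))

-- The fixed field of the automorphism is GF(2). By `herm-sym` every norm `herm Y f f` is fixed, so
-- norms take only two values; this is where parity comes from.
invF-fixed : ∀ x → x ≡ invF x → x ≡ O ⊎ x ≡ I
invF-fixed O  _ = inj₁ refl
invF-fixed I  _ = inj₂ refl

infixl 6 _⊕_
infixr 7 _⊙_

_⊕_ : ∀ {n} → Vect n → Vect n → Vect n
_⊕_ = zipWith _+F_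

_⊙_ : ∀ {n} → GF4 → Vect n → Vect n
a ⊙ v = vmap (a *F_) v

0v : ∀ {n} → Vect n
0v = replicate _ O

lookup-0v : ∀ {n} (i : Fin n) → lookup 0v i ≡ O
lookup-0v i = lookup-replicate i O

lookup-⊕ : ∀ {n} i (u v : Vect n) → lookup (u ⊕ v) i ≡ lookup u i +F lookup v i
lookup-⊕ = lookup-zipWith _+F_

lookup-⊙ : ∀ {n} i a (v : Vect n) → lookup (a ⊙ v) i ≡ a *F lookup v i
lookup-⊙ i a v = lookup-map i (a *F_) v

dot-comm : ∀ {n} (u v : Vect n) → dot u v ≡ dot v u
dot-comm []      []      = refl
dot-comm (x ∷ u) (y ∷ v) = cong₂ _+F_ (*F-comm x y) (dot-comm u v)

dot-⊕ˡ : ∀ {n} (u v w : Vect n) → dot (u ⊕ v) w ≡ dot u w +F dot v w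
dot-⊕ˡ []      []      []      = refl
dot-⊕ˡ (x ∷ u) (y ∷ v) (z ∷ w) = trans (cong₂ _+F_ (distrib x y z) (dot-⊕ˡ u v w)) (interchange (x *F z) (y *F z) (dot u w) (dot v w))
  where
  distrib : ∀ x y z → (x +F y) *F z ≡ (x *F z) +F (y *F z)
  distrib = from-yes (∀F? λ x → ∀F? λ y → ∀F? λ z → ((x +F y) *F z) ≟F ((x *F z) +F (y *F z)))
  interchange : ∀ a b c d → (a +F b) +F (c +F d) ≡ (a +F c) +F (b +F d)
  interchange = from-yes (∀F? λ a → ∀F? λ b → ∀F? λ c → ∀F? λ d → ((a +F b) +F (c +F d)) ≟F ((a +F c) +F (b +F d)))

dot-⊙ˡ : ∀ {n} a (u w : Vect n) → dot (a ⊙ u) w ≡ a *F dot u w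
dot-⊙ˡ a []      []      = sym (*F-zeroʳ a)
dot-⊙ˡ a (x ∷ u) (z ∷ w) = trans (cong (((a *F x) *F z) +F_) (dot-⊙ˡ a u w)) (law a x z (dot u w))
  where
  law : ∀ a x z d → ((a *F x) *F z) +F (a *F d) ≡ a *F ((x *F z) +F d)
  law = from-yes (∀F? λ a → ∀F? λ x → ∀F? λ z → ∀F? λ d → (((a *F x) *F z) +F (a *F d)) ≟F (a *F ((x *F z) +F d)))

dot-0ˡ : ∀ {n} (w : Vect n) → dot 0v w ≡ O
dot-0ˡ []      = refl
dot-0ˡ (_ ∷ w) = dot-0ˡ w

dot-⊕ʳ : ∀ {n} (u v w : Vect n) → dot u (v ⊕ w) ≡ dot u v +F dot u w
dot-⊕ʳ u v w = trans (dot-comm u (v ⊕ w)) (trans (dot-⊕ˡ v w u) (cong₂ _+F_ (dot-comm v u) (dot-comm w u)))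

dot-⊙ʳ : ∀ {n} a (u v : Vect n) → dot u (a ⊙ v) ≡ a *F dot u v
dot-⊙ʳ a u v = trans (dot-comm u (a ⊙ v)) (trans (dot-⊙ˡ a v u) (cong (a *F_) (dot-comm v u)))

dot-0ʳ : ∀ {n} (u : Vect n) → dot u 0v ≡ O
dot-0ʳ u = trans (dot-comm u 0v) (dot-0ˡ u)

-- Linear in `u` and conjugate-linear in `v`.
herm : ∀ {n} → Subset n → Vect n → Vect n → GF4
herm Y u v = dot u (invV (proj Y v))

herm-sym : ∀ {n} Y (u v : Vect n) → herm Y u v ≡ invF (herm Y v u)
herm-sym []          []      []      = refl
herm-sym (false ∷ Y) (x ∷ u) (y ∷ v)
  rewrite *F-zeroʳ x | *F-zeroʳ y = herm-sym Y u v
herm-sym (true ∷ Y)  (x ∷ u) (y ∷ v)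
  rewrite herm-sym Y u v = law x y (herm Y v u)
  where
  law : ∀ x y h → (x *F invF y) +F invF h ≡ invF ((y *F invF x) +F h)
  law = from-yes (∀F? λ x → ∀F? λ y → ∀F? λ h → ((x *F invF y) +F invF h) ≟F invF ((y *F invF x) +F h))

herm-vanish-sym : ∀ {n} Y (u v : Vect n) → herm Y u v ≡ O → herm Y v u ≡ O
herm-vanish-sym Y u v h = trans (herm-sym Y v u) (cong invF h)

herm-⊕ʳ : ∀ {n} Y (u v w : Vect n) → herm Y u (v ⊕ w) ≡ herm Y u v +F herm Y u w
herm-⊕ʳ Y u v w
  rewrite herm-sym Y u (v ⊕ w) | dot-⊕ˡ v w (invV (proj Y u)) | herm-sym Y u v | herm-sym Y u w
  = invF-+ (herm Y v u) (herm Y w u)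

-- The scalar is conjugated in advance so that it leaves the form as `a`, which is what closure
-- under scaling needs in `riesz`.
herm-⊙ʳ : ∀ {n} Y a (u v : Vect n) → herm Y u (invF a ⊙ v) ≡ a *F herm Y u v
herm-⊙ʳ Y a u v
  rewrite herm-sym Y u (invF a ⊙ v) | dot-⊙ˡ (invF a) v (invV (proj Y u)) | herm-sym Y u v
        | invF-* (invF a) (herm Y v u) | invF-involutive a
  = refl

herm-0ʳ : ∀ {n} Y (u : Vect n) → herm Y u 0v ≡ O
herm-0ʳ Y u = herm-vanish-sym Y 0v u (dot-0ˡ (invV (proj Y u)))

herm-∅ : ∀ {n} (u v : Vect n) → herm (replicate n false) u v ≡ O
herm-∅ []      []      = refl
herm-∅ (x ∷ u) (y ∷ v) rewrite *F-zeroʳ x = herm-∅ u v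

herm-insert : ∀ {n} Y i (u v : Vect n) → lookup Y i ≡ false →
  herm (Y [ i ]≔ true) u v ≡ herm Y u v +F (lookup u i *F invF (lookup v i))
herm-insert (false ∷ Y) zero    (x ∷ u) (y ∷ v) _
  rewrite *F-zeroʳ x = +F-comm (x *F invF y) (herm Y u v)
  where
  +F-comm : ∀ a b → a +F b ≡ b +F a
  +F-comm = from-yes (∀F? λ a → ∀F? λ b → (a +F b) ≟F (b +F a))
herm-insert (b ∷ Y)     (suc i) (x ∷ u) (y ∷ v) i∉Y
  rewrite herm-insert Y i u v i∉Y
  = assoc (x *F invF (if b then y else O)) (herm Y u v) (lookup u i *F invF (lookup v i))
  where
  assoc : ∀ a b c → a +F (b +F c) ≡ (a +F b) +F c
  assoc = from-yes (∀F? λ a → ∀F? λ b → ∀F? λ c → (a +F (b +F c)) ≟F ((a +F b) +F c))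

-- Subspaces and duality

-- Decidable membership is part of the structure, so that case distinctions and witnesses come from
-- finite search.
record Subspace {n} (L : Vect n → Set) : Set where
  field
    mem?     : ∀ v → Dec (L v)
    0-mem    : L 0v
    ⊕-closed : ∀ {u v} → L u → L v → L (u ⊕ v)
    ⊙-closed : ∀ a {v} → L v → L (a ⊙ v)

open Subspace

_⊥_ : ∀ {n} → (Vect n → Set) → Vect n → Set
L ⊥ y = ∀ u → L u → dot y u ≡ O

⊕-swap : ∀ {n} (u v : Vect n) → u ⊕ (v ⊕ u) ≡ v
⊕-swap []      []      = refl
⊕-swap (x ∷ u) (y ∷ v) = cong₂ _∷_ (+F-swap x y) (⊕-swap u v)

tail-subspace : ∀ {n} {L : Vect (suc n) → Set} → Subspace L → Subspace (λ v → L (O ∷ v))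
tail-subspace S .mem? v = mem? S (O ∷ v)
tail-subspace S .0-mem = 0-mem S
tail-subspace S .⊕-closed = ⊕-closed S
tail-subspace {L = L} S .⊙-closed a {v} m = subst (λ x → L (x ∷ a ⊙ v)) (*F-zeroʳ a) (⊙-closed S a m)

-- L^⊥⊥ = L.  If L contains some (1 , t), clear the first coordinate with it;
-- otherwise the first coordinate vanishes on L.
mem-or-separated : ∀ {n} {L : Vect n → Set} → Subspace L → ∀ e → L e ⊎ ∃ λ y → (L ⊥ y) × dot y e ≢ O
mem-or-separated {zero} S [] = inj₁ (0-mem S)
mem-or-separated {suc n} {L} S (a ∷ e) with ∃V? (λ t → mem? S (I ∷ t))
... | yes (t , t∈L) with mem-or-separated (tail-subspace S) (e ⊕ a ⊙ t)
...   | inj₁ m = inj₁ (subst L (cong₂ _∷_ (head-eq a) (⊕-swap (a ⊙ t) e))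
                     (⊕-closed S (⊙-closed S a t∈L) m))
  where
  head-eq : ∀ a → (a *F I) +F O ≡ a
  head-eq = from-yes (∀F? λ a → ((a *F I) +F O) ≟F a)
-- The new first entry makes the functional vanish on (1 , t), by characteristic 2; its value at any
-- vector is then that of `y` on the tail cleared by t.
...   | inj₂ (y , y⊥ , y∦) = inj₂ (dot y t ∷ y , separates , λ p → y∦ (trans (reduced a e) p))
  where
  reduced : ∀ b s → dot y (s ⊕ b ⊙ t) ≡ (dot y t *F b) +F dot y s
  reduced b s rewrite dot-⊕ʳ y s (b ⊙ t) | dot-⊙ʳ b y t = law (dot y s) b (dot y t)
    where
    law : ∀ x b c → x +F (b *F c) ≡ (c *F b) +F x
    law = from-yes (∀F? λ x → ∀F? λ b → ∀F? λ c → (x +F (b *F c)) ≟F ((c *F b) +F x))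
  head-eq : ∀ b → b +F (b *F I) ≡ O
  head-eq = from-yes (∀F? λ b → (b +F (b *F I)) ≟F O)
  separates : L ⊥ (dot y t ∷ y)
  separates (b ∷ s) m = trans (sym (reduced b s))
    (y⊥ (s ⊕ b ⊙ t) (subst (λ x → L (x ∷ s ⊕ b ⊙ t)) (head-eq b) (⊕-closed S m (⊙-closed S b t∈L))))
mem-or-separated {suc n} {L} S (a ∷ e) | no none with a ≟F O
... | no a≢O = inj₂ (I ∷ 0v , separates , λ p → a≢O (trans (sym (dot-I∷0 a e)) p))
  where
  dot-I∷0 : ∀ b s → dot (I ∷ 0v) (b ∷ s) ≡ b
  dot-I∷0 b s rewrite dot-0ˡ s = law b
    where
    law : ∀ b → (I *F b) +F O ≡ b
    law = from-yes (∀F? λ b → ((I *F b) +F O) ≟F b)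
  separates : L ⊥ (I ∷ 0v)
  separates (b ∷ s) m with b ≟F O
  ... | yes refl = dot-I∷0 O s
  ... | no b≢O   = contradiction
    (invF b ⊙ s , subst (λ x → L (x ∷ invF b ⊙ s)) (invF-inverse b b≢O) (⊙-closed S (invF b) m)) none
... | yes refl with mem-or-separated (tail-subspace S) e
...   | inj₁ m = inj₁ m
...   | inj₂ (y , y⊥ , y∦) = inj₂ (O ∷ y , separates , y∦)
  where
  separates : L ⊥ (O ∷ y)
  separates (b ∷ s) m with b ≟F O
  ... | yes refl = y⊥ s m
  ... | no b≢O   = contradiction
    (invF b ⊙ s , subst (λ x → L (x ∷ invF b ⊙ s)) (invF-inverse b b≢O) (⊙-closed S (invF b) m)) none

-- Radicals, nondegeneracy and Riesz representation

Radical : ∀ {n} → (Vect n → Set) → Subset n → Vect n → Set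
Radical K Y v = K v × (∀ u → K u → herm Y u v ≡ O)

Nondegenerate : ∀ {n} → (Vect n → Set) → Subset n → Set
Nondegenerate K Y = ∀ v → Radical K Y v → v ≡ 0v

module _ {n} {K : Vect n → Set} (S : Subspace K) where

  radical? : ∀ Y v → Dec (Radical K Y v)
  radical? Y v = mem? S v ×-dec ∀V? (λ u → mem? S u →-dec (herm Y u v ≟F O))

  nondegenerate? : ∀ Y → Dec (Nondegenerate K Y)
  nondegenerate? Y = ∀V? (λ v → radical? Y v →-dec (v ≟V 0v))

  degenerate-witness : ∀ Y → ¬ Nondegenerate K Y → ∃ λ s → Radical K Y s × s ≢ 0v
  degenerate-witness Y deg with ∃V? (λ s → radical? Y s ×-dec ¬? (s ≟V 0v))
  ... | yes w = w
  ... | no none = contradiction (λ v r → decidable-stable (v ≟V 0v) (λ v≢0 → none (v , r , v≢0))) deg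

  -- The vectors whose functional on K has the form `herm Y v k` form a subspace. If the functional
  -- of `e` were missing, a vector `y` would separate it. Such a `y` lies in K by double
  -- annihilation and is orthogonal to K, so nondegeneracy makes it zero, a contradiction.
  riesz : ∀ Y → Nondegenerate K Y → ∀ e → ∃ λ k → K k × (∀ v → K v → herm Y v e ≡ herm Y v k)
  riesz Y nondeg e with mem-or-separated represented-subspace (invV (proj Y e))
    where
    Represented : Vect n → Set
    Represented x = ∃ λ k → K k × (∀ v → K v → dot v x ≡ herm Y v k)
    represented-subspace : Subspace Represented
    represented-subspace .mem? x =
      ∃V? (λ k → mem? S k ×-dec ∀V? (λ v → mem? S v →-dec (dot v x ≟F herm Y v k)))
    represented-subspace .0-mem = 0v , 0-mem S , λ v _ → trans (dot-0ʳ v) (sym (herm-0ʳ Y v))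
    represented-subspace .⊕-closed {x} {x′} (k , k∈K , h) (k′ , k′∈K , h′) =
      k ⊕ k′ , ⊕-closed S k∈K k′∈K ,
      λ v v∈K → trans (dot-⊕ʳ v x x′) (trans (cong₂ _+F_ (h v v∈K) (h′ v v∈K)) (sym (herm-⊕ʳ Y v k k′)))
    represented-subspace .⊙-closed a {x} (k , k∈K , h) =
      invF a ⊙ k , ⊙-closed S (invF a) k∈K ,
      λ v v∈K → trans (dot-⊙ʳ a v x) (trans (cong (a *F_) (h v v∈K)) (sym (herm-⊙ʳ Y a v k)))
  ... | inj₁ r = r
  ... | inj₂ (y , y⊥ , y∦) = contradiction y≡0 (λ { refl → y∦ (dot-0ˡ (invV (proj Y e))) })
    where
    y∈K : K y
    y∈K with mem-or-separated S y
    ... | inj₁ m = m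
    -- As `z` annihilates K, it is represented by `0v`, so `y` must annihilate it.
    ... | inj₂ (z , z⊥ , z∦) = contradiction
      (trans (dot-comm z y) (y⊥ z (0v , 0-mem S , λ v v∈K → trans (dot-comm v z) (trans (z⊥ v v∈K) (sym (herm-0ʳ Y v))))))
      z∦
    y≡0 : y ≡ 0v
    -- Each `invV (proj Y u)` with `u` in K is represented by `u` itself.
    y≡0 = nondeg y (y∈K , λ u u∈K →
      herm-vanish-sym Y y u (y⊥ (invV (proj Y u)) (u , u∈K , λ _ _ → refl)))

-- Inserting a coordinate into Y

herm-agree : ∀ {n} Y (i : Fin n) → lookup Y i ≡ false → ∀ u v → lookup u i ≡ O ⊎ lookup v i ≡ O →
  herm (Y [ i ]≔ true) u v ≡ herm Y u v
herm-agree Y i i∉Y u v h = trans (herm-insert Y i u v i∉Y)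
  (trans (cong (herm Y u v +F_) (vanishes h)) (+F-identityʳ _))
  where
  vanishes : lookup u i ≡ O ⊎ lookup v i ≡ O → lookup u i *F invF (lookup v i) ≡ O
  vanishes (inj₁ p) rewrite p = refl
  vanishes (inj₂ p) rewrite p = *F-zeroʳ (lookup u i)

nondegenerate-insert : ∀ {n} {K : Vect n → Set} Y (i : Fin n) → lookup Y i ≡ false →
  (∀ {v} → K v → lookup v i ≡ O) → Nondegenerate K Y ⇔ Nondegenerate K (Y [ i ]≔ true)
nondegenerate-insert Y i i∉Y vanish = mk⇔
  (λ nondeg v (v∈K , v-rad) → nondeg v (v∈K , λ u u∈K →
    trans (sym (herm-agree Y i i∉Y u v (inj₂ (vanish v∈K)))) (v-rad u u∈K)))
  (λ nondeg v (v∈K , v-rad) → nondeg v (v∈K , λ u u∈K →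
    trans (herm-agree Y i i∉Y u v (inj₂ (vanish v∈K))) (v-rad u u∈K)))

-- K′ is the hyperplane of K on which the coordinate i vanishes; the forms of Y
-- and Y ∪ {i} agree as soon as one argument lies in that hyperplane.
module Hyperplane {n} {K K′ : Vect n → Set} (S : Subspace K) (S′ : Subspace K′) (i : Fin n)
  (K′-split : ∀ {v} → K′ v → K v × lookup v i ≡ O)
  (K′-join : ∀ {v} → K v → lookup v i ≡ O → K′ v)
  where

  Agree : Subset n → Subset n → Set
  Agree Y₁ Y₂ = ∀ u v → lookup u i ≡ O ⊎ lookup v i ≡ O → herm Y₁ u v ≡ herm Y₂ u v

  -- In characteristic 2 the vector `u ⊕ lookup u i ⊙ e` vanishes at `i`, so it lies in K′ and pairs
  -- to zero with `s`. Pairing with `s` thus depends only on the coordinate `i`.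
  scaling : ∀ {Y e s u} → K e → lookup e i ≡ I → (∀ v → K′ v → herm Y v s ≡ O) →
            K u → herm Y u s ≡ lookup u i *F herm Y e s
  scaling {Y} {e} {s} {u} e∈K eᵢ≡I s⊥ u∈K =
    +F-cancel _ _ (trans (sym (trans (dot-⊕ˡ u (lookup u i ⊙ e) _) (cong (herm Y u s +F_) (dot-⊙ˡ (lookup u i) e _))))
      (s⊥ (u ⊕ lookup u i ⊙ e) (K′-join (⊕-closed S u∈K (⊙-closed S (lookup u i) e∈K)) vanishes)))
    where
    vanishes : lookup (u ⊕ lookup u i ⊙ e) i ≡ O
    vanishes rewrite lookup-⊕ i u (lookup u i ⊙ e) | lookup-⊙ i (lookup u i) e | eᵢ≡I
                   | *F-identityʳ (lookup u i) = +F-self (lookup u i)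

  -- A vector s ≠ 0 in the radical of K′ must pair nontrivially with e, which
  -- forces the radical of K into K′.
  degenerate-transfer : ∀ {Y₁ Y₂ e} → Agree Y₁ Y₂ → K e → lookup e i ≡ I →
    ¬ Nondegenerate K′ Y₁ → Nondegenerate K Y₁ → Nondegenerate K Y₂
  degenerate-transfer {Y₁} {Y₂} {e} agree e∈K eᵢ≡I deg nondeg u (u∈K , u-rad)
    with s , (s∈K′ , s-rad) , s≢0 ← degenerate-witness S′ Y₁ deg
    = nondeg u (u∈K , λ w w∈K → trans (agree w u (inj₂ uᵢ≡O)) (u-rad w w∈K))
    where
    paired : herm Y₁ e s ≢ O
    paired es≡O = s≢0 (nondeg s (proj₁ (K′-split s∈K′) , λ w w∈K →
      trans (scaling e∈K eᵢ≡I s-rad w∈K) (trans (cong (lookup w i *F_) es≡O) (*F-zeroʳ (lookup w i)))))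
    uᵢ≡O : lookup u i ≡ O
    uᵢ≡O = *F-integral _ _ paired (trans (sym (scaling e∈K eᵢ≡I s-rad u∈K))
      (trans (agree u s (inj₂ (proj₂ (K′-split s∈K′))))
        (herm-vanish-sym Y₂ s u (u-rad s (proj₁ (K′-split s∈K′))))))

  -- Being orthogonal to K′ and to itself, `e` is orthogonal to all of K by `scaling`; its entry I
  -- at `i` shows that it is nonzero.
  isotropic-degenerate : ∀ {Y e} → K e → lookup e i ≡ I → (∀ v → K′ v → herm Y v e ≡ O) →
    herm Y e e ≡ O → ¬ Nondegenerate K Y
  isotropic-degenerate {Y} {e} e∈K eᵢ≡I e⊥ ee≡O nondeg
    with () ← trans (sym eᵢ≡I) (trans (cong (λ v → lookup v i)
      (nondeg e (e∈K , λ w w∈K → trans (scaling e∈K eᵢ≡I e⊥ w∈K)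
        (trans (cong (lookup w i *F_) ee≡O) (*F-zeroʳ (lookup w i)))))) (lookup-0v i))

  -- A radical vector of K pairs to zero with `e`, whose norm is nonzero, so by `scaling` it
  -- vanishes at `i` and lies in the radical of K′.
  anisotropic-nondegenerate : ∀ {Y e} → K e → lookup e i ≡ I → (∀ v → K′ v → herm Y v e ≡ O) →
    herm Y e e ≢ O → Nondegenerate K′ Y → Nondegenerate K Y
  anisotropic-nondegenerate {Y} {e} e∈K eᵢ≡I e⊥ ee≢O nondeg u (u∈K , u-rad) =
    nondeg u (K′-join u∈K uᵢ≡O , λ w w∈K′ → u-rad w (proj₁ (K′-split w∈K′)))
    where
    uᵢ≡O : lookup u i ≡ O
    uᵢ≡O = *F-integral _ _ ee≢O (trans (sym (scaling e∈K eᵢ≡I e⊥ u∈K)) (herm-vanish-sym Y e u (u-rad e e∈K)))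

  module _ (Y : Subset n) (i∉Y : lookup Y i ≡ false) where

    Y⁺ : Subset n
    Y⁺ = Y [ i ]≔ true

    agree⁺ : Agree Y⁺ Y
    agree⁺ = herm-agree Y i i∉Y

    agree⁻ : Agree Y Y⁺
    agree⁻ u v h = sym (agree⁺ u v h)

    -- If the form on K′ is degenerate, `degenerate-transfer` in both directions makes the answers
    -- for Y and Y⁺ equal. Otherwise the pivot is made orthogonal to K′, and its norm alone decides.
    nondegenerate-step : ∀ {e} → K e → lookup e i ≡ I → ∀ {a b c} → Reflects (Nondegenerate K Y⁺) a →
      Reflects (Nondegenerate K′ Y) b → Reflects (Nondegenerate K Y) c → a ≡ b xor c
    nondegenerate-step {e} e∈K eᵢ≡I {a} {c = c} ra (ofⁿ deg) rc = det ra
      (reflects-map (mk⇔ (degenerate-transfer agree⁻ e∈K eᵢ≡I deg) (degenerate-transfer agree⁺ e∈K eᵢ≡I deg⁺)) rc)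
      where
      deg⁺ : ¬ Nondegenerate K′ Y⁺
      deg⁺ = deg ∘ from (nondegenerate-insert Y i i∉Y (proj₂ ∘ K′-split))
    -- e ⊕ k is orthogonal to K′, and its two norms differ by 1.
    nondegenerate-step {e} e∈K eᵢ≡I {a} {c = c} ra (ofʸ nondeg) rc
      with k , k∈K′ , k-rep ← riesz S′ Y nondeg e = exclusive (invF-fixed _ (herm-sym Y f f))
      where
      f : Vect n
      f = e ⊕ k
      f∈K : K f
      f∈K = ⊕-closed S e∈K (proj₁ (K′-split k∈K′))
      fᵢ≡I : lookup f i ≡ I
      fᵢ≡I rewrite lookup-⊕ i e k | eᵢ≡I | proj₂ (K′-split k∈K′) = refl
      f⊥ : ∀ v → K′ v → herm Y v f ≡ O
      f⊥ v v∈K′ rewrite herm-⊕ʳ Y v e k | k-rep v v∈K′ = +F-self (herm Y v k)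
      f⊥⁺ : ∀ v → K′ v → herm Y⁺ v f ≡ O
      f⊥⁺ v v∈K′ = trans (agree⁺ v f (inj₁ (proj₂ (K′-split v∈K′)))) (f⊥ v v∈K′)
      norm⁺ : herm Y⁺ f f ≡ herm Y f f +F I
      norm⁺ rewrite herm-insert Y i f f i∉Y | fᵢ≡I = refl
      nondeg⁺ : Nondegenerate K′ Y⁺
      nondeg⁺ = to (nondegenerate-insert Y i i∉Y (proj₂ ∘ K′-split)) nondeg
      -- Both norms of `f` lie in GF(2) and differ by 1, so exactly one of the two forms has an
      -- isotropic `f`.
      exclusive : herm Y f f ≡ O ⊎ herm Y f f ≡ I →
        a ≡ not c
      exclusive (inj₁ ff≡O) = det ra
        (reflects-map (mk⇔
          (λ _ → anisotropic-nondegenerate f∈K fᵢ≡I f⊥⁺ (λ p → I≢O (trans (sym (trans norm⁺ (cong (_+F I) ff≡O))) p)) nondeg⁺)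
          (λ _ → isotropic-degenerate f∈K fᵢ≡I f⊥ ff≡O))
          (¬-reflects rc))
      exclusive (inj₂ ff≡I) = det ra
        (reflects-map (mk⇔
          (λ deg → contradiction (anisotropic-nondegenerate f∈K fᵢ≡I f⊥ (λ p → I≢O (trans (sym ff≡I) p)) nondeg) deg)
          (λ nd → contradiction nd (isotropic-degenerate f∈K fᵢ≡I f⊥⁺ (trans norm⁺ (cong (_+F I) ff≡I)))))
          (¬-reflects rc))

-- Restriction to a subset of the coordinates

SupportedIn : ∀ {n} → Subset n → Vect n → Set
SupportedIn Z v = ∀ i → lookup Z i ≡ false → lookup v i ≡ O

_↾_ : ∀ {n} → (Vect n → Set) → Subset n → Vect n → Set
(L ↾ Z) v = L v × SupportedIn Z v

-- The entries of `t` inside Z are ignored. For `L = Ker B` the condition says that the columns in Z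
-- span all columns.
OntoOutside : ∀ {n} → (Vect n → Set) → Subset n → Set
OntoOutside L Z = ∀ t → ∃ λ v → L v × (∀ j → lookup Z j ≡ false → lookup v j ≡ lookup t j)

Admissible : ∀ {n} → (Vect n → Set) → Subset n → Subset n → Set
Admissible L Y Z = OntoOutside L Z × Nondegenerate (L ↾ Z) Y

unit : ∀ {n} → Fin n → Vect n
unit i = 0v [ i ]≔ I

lookup-unit : ∀ {n} (i : Fin n) → lookup (unit i) i ≡ I
lookup-unit i = lookup∘update i 0v I

lookup-unit-≢ : ∀ {n} {i j : Fin n} → j ≢ i → lookup (unit i) j ≡ O
lookup-unit-≢ {j = j} j≢i = trans (lookup∘update′ j≢i 0v I) (lookup-0v j)

dot-unit : ∀ {n} (y : Vect n) i → dot y (unit i) ≡ lookup y i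
dot-unit (x ∷ y) zero    rewrite dot-0ʳ y = trans (+F-identityʳ (x *F I)) (*F-identityʳ x)
dot-unit (x ∷ y) (suc i) rewrite *F-zeroʳ x = dot-unit y i

-- By double annihilation: a vector annihilating every unit vector has all entries zero, so nothing
-- can be separated from L.
units-span : ∀ {n} {L : Vect n → Set} → Subspace L → (∀ i → L (unit i)) → ∀ t → L t
units-span S units t with mem-or-separated S t
... | inj₁ m = m
... | inj₂ (y , y⊥ , y∦) = contradiction (trans (cong (λ w → dot w t) y≡0) (dot-0ˡ t)) y∦
  where
  y≡0 : y ≡ 0v
  y≡0 = vec-ext λ i → trans (sym (dot-unit y i)) (trans (y⊥ (unit i) (units i)) (sym (lookup-0v i)))

outside-insert : ∀ {n} (Z : Subset n) i j → lookup (Z [ i ]≔ true) j ≡ false → j ≢ i × lookup Z j ≡ false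
outside-insert Z i j out = j≢i , trans (sym (lookup∘update′ j≢i Z true)) out
  where
  j≢i : j ≢ i
  j≢i refl with () ← trans (sym (lookup∘update i Z true)) out

outside-cases : ∀ {n} (Z : Subset n) i j → lookup Z j ≡ false → j ≡ i ⊎ lookup (Z [ i ]≔ true) j ≡ false
outside-cases Z i j out with j Fin.≟ i
... | yes j≡i = inj₁ j≡i
... | no  j≢i = inj₂ (trans (lookup∘update′ j≢i Z true) out)

supported-insert : ∀ {n} (Z : Subset n) i v → SupportedIn Z v → SupportedIn (Z [ i ]≔ true) v
supported-insert Z i v s j out = s j (proj₂ (outside-insert Z i j out))

supported-remove : ∀ {n} (Z : Subset n) i v → SupportedIn (Z [ i ]≔ true) v → lookup v i ≡ O → SupportedIn Z v
supported-remove Z i v s vᵢ≡O j out with outside-cases Z i j out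
... | inj₁ refl = vᵢ≡O
... | inj₂ out⁺ = s j out⁺

normalise : ∀ {n} (i : Fin n) v → lookup v i ≢ O → lookup (invF (lookup v i) ⊙ v) i ≡ I
normalise i v vᵢ≢O = trans (lookup-⊙ i (invF (lookup v i)) v) (invF-inverse _ vᵢ≢O)

reflects-false : {P : Set} {b : Bool} → ¬ P → Reflects P b → b ≡ false
reflects-false ¬p r = det r (ofⁿ ¬p)

-- Admissible sets and their parity recursion

module _ {n} {L : Vect n → Set} (S : Subspace L) where

  ↾-subspace : ∀ Z → Subspace (L ↾ Z)
  ↾-subspace Z .mem? v = mem? S v ×-dec Fin.all? (λ i → (lookup Z i Bool.≟ false) →-dec (lookup v i ≟F O))
  ↾-subspace Z .0-mem = 0-mem S , λ i _ → lookup-0v i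
  ↾-subspace Z .⊕-closed {u} {v} (u∈L , su) (v∈L , sv) = ⊕-closed S u∈L v∈L ,
    λ i out → trans (lookup-⊕ i u v) (cong₂ _+F_ (su i out) (sv i out))
  ↾-subspace Z .⊙-closed a {v} (v∈L , sv) = ⊙-closed S a v∈L ,
    λ i out → trans (lookup-⊙ i a v) (trans (cong (a *F_) (sv i out)) (*F-zeroʳ a))

  radical-subspace : ∀ Y → Subspace (Radical L Y)
  radical-subspace Y .mem? = radical? S Y
  radical-subspace Y .0-mem = 0-mem S , λ u _ → herm-0ʳ Y u
  radical-subspace Y .⊕-closed {v} {w} (v∈L , rv) (w∈L , rw) = ⊕-closed S v∈L w∈L ,
    λ u u∈L → trans (herm-⊕ʳ Y u v w) (cong₂ _+F_ (rv u u∈L) (rw u u∈L))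
  radical-subspace Y .⊙-closed a {v} (v∈L , rv) = ⊙-closed S a v∈L ,
    λ u u∈L → herm-vanish-sym Y (a ⊙ v) u
      (trans (dot-⊙ˡ a v _) (trans (cong (a *F_) (herm-vanish-sym Y u v (rv u u∈L))) (*F-zeroʳ a)))

  ontoOutside? : ∀ Z → Dec (OntoOutside L Z)
  ontoOutside? Z = ∀V? λ t → ∃V? λ v → mem? S v ×-dec
    Fin.all? (λ j → (lookup Z j Bool.≟ false) →-dec (lookup v j ≟F lookup t j))

  admissible? : ∀ Y Z → Dec (Admissible L Y Z)
  admissible? Y Z = ontoOutside? Z ×-dec nondegenerate? (↾-subspace Z) Y

  -- Vectors supported in Z vanish at `i`, so the added rank-one term is zero on them.
  admissible-outside : ∀ Y Z i → lookup Y i ≡ false → lookup Z i ≡ false →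
    Admissible L Y Z ⇔ Admissible L (Y [ i ]≔ true) Z
  admissible-outside Y Z i i∉Y i∉Z =
    mk⇔ (λ (onto , nondeg) → onto , to e nondeg) (λ (onto , nondeg) → onto , from e nondeg)
    where
    e : Nondegenerate (L ↾ Z) Y ⇔ Nondegenerate (L ↾ Z) (Y [ i ]≔ true)
    e = nondegenerate-insert Y i i∉Y (λ (_ , s) → s i i∉Z)

  module _ (Z : Subset n) (i : Fin n) (i∉Z : lookup Z i ≡ false) where

    private
      Z⁺ : Subset n
      Z⁺ = Z [ i ]≔ true

    onto-insert : OntoOutside L Z → OntoOutside L Z⁺
    onto-insert onto t with v , v∈L , h ← onto t = v , v∈L , λ j out → h j (proj₂ (outside-insert Z i j out))

    onto-pivot : OntoOutside L Z → ∃ λ e → (L ↾ Z⁺) e × lookup e i ≡ I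
    onto-pivot onto with v , v∈L , h ← onto (unit i) =
      v , (v∈L , λ j out → let j≢i , out′ = outside-insert Z i j out in trans (h j out′) (lookup-unit-≢ j≢i)) ,
      trans (h i i∉Z) (lookup-unit i)

    -- Outside Z the pivot `e` is nonzero only at `i`, so a multiple of it corrects the entry at `i`
    -- and leaves the rest of the lift unchanged there. The sum `a` is the required difference, by
    -- characteristic 2.
    onto-remove : OntoOutside L Z⁺ → ∀ {e} → (L ↾ Z⁺) e → lookup e i ≡ I → OntoOutside L Z
    onto-remove onto⁺ {e} (e∈L , e-supp) eᵢ≡I t with v , v∈L , h ← onto⁺ t =
      v ⊕ a ⊙ e , ⊕-closed S v∈L (⊙-closed S a e∈L) , matches
      where
      a : GF4
      a = lookup t i +F lookup v i
      matches : ∀ j → lookup Z j ≡ false → lookup (v ⊕ a ⊙ e) j ≡ lookup t j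
      matches j out rewrite lookup-⊕ j v (a ⊙ e) | lookup-⊙ j a e with outside-cases Z i j out
      ... | inj₁ refl rewrite eᵢ≡I | *F-identityʳ a = +F-swap (lookup v i) (lookup t i)
      ... | inj₂ out⁺ rewrite e-supp j out⁺ | *F-zeroʳ a = trans (+F-identityʳ _) (h j out⁺)

    -- If L is not onto outside Z⁺, all three sets fail. With a pivot, L is also onto outside Z, and
    -- L ↾ Z is the hyperplane of L ↾ Z⁺ at `i`. Without one, Z is not admissible and every vector
    -- of L ↾ Z⁺ vanishes at `i`, so the two forms coincide.
    admissible-inside : ∀ Y → lookup Y i ≡ false → ∀ {a b c} → Reflects (Admissible L (Y [ i ]≔ true) Z⁺) a →
      Reflects (Admissible L Y Z) b → Reflects (Admissible L Y Z⁺) c → a ≡ b xor c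
    admissible-inside Y i∉Y {a} {b} {c} ra rb rc with ontoOutside? Z⁺
    ... | no ¬onto⁺
      rewrite reflects-false (¬onto⁺ ∘ proj₁) ra | reflects-false (¬onto⁺ ∘ onto-insert ∘ proj₁) rb
            | reflects-false (¬onto⁺ ∘ proj₁) rc = refl
    ... | yes onto⁺ with ∃V? (λ e → mem? (↾-subspace Z⁺) e ×-dec (lookup e i ≟F I))
    ...   | yes (e , e∈K , eᵢ≡I) =
      Hyperplane.nondegenerate-step (↾-subspace Z⁺) (↾-subspace Z) i
        (λ {v} (v∈L , s) → (v∈L , supported-insert Z i v s) , s i i∉Z)
        (λ {v} (v∈L , s) vᵢ≡O → v∈L , supported-remove Z i v s vᵢ≡O)
        Y i∉Y e∈K eᵢ≡I
        (reflects-map (mk⇔ proj₂ (onto⁺ ,_)) ra)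
        (reflects-map (mk⇔ proj₂ (onto-remove onto⁺ e∈K eᵢ≡I ,_)) rb)
        (reflects-map (mk⇔ proj₂ (onto⁺ ,_)) rc)
    ...   | no none rewrite reflects-false (none ∘ onto-pivot ∘ proj₁) rb =
      det ra (reflects-map (mk⇔ (λ (o , nondeg) → o , to e nondeg) (λ (o , nondeg) → o , from e nondeg)) rc)
      where
      e : Nondegenerate (L ↾ Z⁺) Y ⇔ Nondegenerate (L ↾ Z⁺) (Y [ i ]≔ true)
      e = nondegenerate-insert Y i i∉Y λ {v} v∈K → decidable-stable (lookup v i ≟F O)
        λ vᵢ≢O → none (_ , ⊙-closed (↾-subspace Z⁺) (invF (lookup v i)) v∈K , normalise i v vᵢ≢O)

-- Loop complementation

module _ {A : Set} where

  odd-countB-++ : (p : A → Bool) (xs ys : List A) →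
    oddN (countB p (xs ++ ys)) ≡ oddN (countB p xs) xor oddN (countB p ys)
  odd-countB-++ p []       ys = refl
  odd-countB-++ p (x ∷ xs) ys with p x
  ... | true  = trans (cong not (odd-countB-++ p xs ys)) (not-distribˡ-xor (oddN (countB p xs)) _)
  ... | false = odd-countB-++ p xs ys

  countB-cong : {p q : A → Bool} → (∀ x → p x ≡ q x) → ∀ xs → countB p xs ≡ countB q xs
  countB-cong h []       = refl
  countB-cong h (x ∷ xs) rewrite h x | countB-cong h xs = refl

  countB-none : {p : A → Bool} → (∀ x → p x ≡ false) → ∀ xs → countB p xs ≡ 0
  countB-none h []       = refl
  countB-none h (x ∷ xs) rewrite h x = countB-none h xs

countB-map : {A B : Set} (p : B → Bool) (f : A → B) (xs : List A) → countB p (map f xs) ≡ countB (p ∘ f) xs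
countB-map p f []       = refl
countB-map p f (x ∷ xs) rewrite countB-map p f xs = refl

odd-countB-allSubsets : ∀ {n} (p : Subset (suc n) → Bool) → oddN (countB p (allSubsets (suc n))) ≡
  oddN (countB (p ∘ (false ∷_)) (allSubsets n)) xor oddN (countB (p ∘ (true ∷_)) (allSubsets n))
odd-countB-allSubsets {n} p
  rewrite odd-countB-++ p (map (false ∷_) (allSubsets n)) (map (true ∷_) (allSubsets n) ++ [])
        | odd-countB-++ p (map (true ∷_) (allSubsets n)) []
        | countB-map p (false ∷_) (allSubsets n) | countB-map p (true ∷_) (allSubsets n)
        | xor-identityʳ (oddN (countB (p ∘ (true ∷_)) (allSubsets n))) = refl

loopCompl-cong : ∀ {n} {D D′ : SetSystem n} → (∀ Z → D Z ≡ D′ Z) → ∀ Y Z → loopCompl D Y Z ≡ loopCompl D′ Y Z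
loopCompl-cong {n} h Y Z = cong oddN (countB-cong
  (λ W → cong (λ b → ((Z ∖B Y) ⊆B W) ∧ ((W ⊆B Z) ∧ b)) (h W)) (allSubsets n))

-- In this and the next two lemmas, the first element is forced out of W when it is outside Z,
-- forced into W when it is in Z but not in Y, and free when it is in both.
loopCompl-∉ : ∀ {n} (D : SetSystem (suc n)) y Y Z →
  loopCompl D (y ∷ Y) (false ∷ Z) ≡ loopCompl (D ∘ (false ∷_)) Y Z
loopCompl-∉ {n} D y Y Z = trans (odd-countB-allSubsets {n} _) (trans
  (cong (λ k → loopCompl (D ∘ (false ∷_)) Y Z xor oddN k)
    (countB-none (λ W → ∧-zeroʳ ((Z ∖B Y) ⊆B W)) (allSubsets n)))
  (xor-identityʳ _))

loopCompl-∈-∉ : ∀ {n} (D : SetSystem (suc n)) Y Z →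
  loopCompl D (false ∷ Y) (true ∷ Z) ≡ loopCompl (D ∘ (true ∷_)) Y Z
loopCompl-∈-∉ {n} D Y Z = trans (odd-countB-allSubsets {n} _)
  (cong (λ k → oddN k xor loopCompl (D ∘ (true ∷_)) Y Z) (countB-none (λ W → refl) (allSubsets n)))

loopCompl-∈-∈ : ∀ {n} (D : SetSystem (suc n)) Y Z →
  loopCompl D (true ∷ Y) (true ∷ Z) ≡ loopCompl (D ∘ (false ∷_)) Y Z xor loopCompl (D ∘ (true ∷_)) Y Z
loopCompl-∈-∈ {n} D Y Z = odd-countB-allSubsets {n} _

-- Induction on the ground set. Fixing whether the first element is in Z, with that element outside
-- Y, gives a family that inherits both rules; the rules at `zero` then bring the first element into
-- Y.
loopCompl-unique : ∀ {n} (N : Subset n → SetSystem n) →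
  (∀ Y Z i → lookup Y i ≡ false → lookup Z i ≡ false → N (Y [ i ]≔ true) Z ≡ N Y Z) →
  (∀ Y Z i → lookup Y i ≡ false → lookup Z i ≡ false →
    N (Y [ i ]≔ true) (Z [ i ]≔ true) ≡ N Y Z xor N Y (Z [ i ]≔ true)) →
  ∀ Y Z → loopCompl (N (replicate n false)) Y Z ≡ N Y Z
loopCompl-unique {zero} N outside inside [] [] with N [] []
... | true  = refl
... | false = refl
loopCompl-unique {suc n} N outside inside (y ∷ Y) (z ∷ Z) = step y z
  where
  slice : ∀ b → loopCompl (N (replicate (suc n) false) ∘ (b ∷_)) Y Z ≡ N (false ∷ Y) (b ∷ Z)
  slice b = loopCompl-unique (λ Y Z → N (false ∷ Y) (b ∷ Z))
    (λ Y Z i → outside (false ∷ Y) (b ∷ Z) (suc i)) (λ Y Z i → inside (false ∷ Y) (b ∷ Z) (suc i)) Y Z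
  step : ∀ y z → loopCompl (N (replicate (suc n) false)) (y ∷ Y) (z ∷ Z) ≡ N (y ∷ Y) (z ∷ Z)
  step false false = trans (loopCompl-∉ _ false Y Z) (slice false)
  step true  false = trans (loopCompl-∉ _ true Y Z)
    (trans (slice false) (sym (outside (false ∷ Y) (false ∷ Z) zero refl refl)))
  step false true  = trans (loopCompl-∈-∉ _ Y Z) (slice true)
  step true  true  = trans (loopCompl-∈-∈ _ Y Z)
    (trans (cong₂ _xor_ (slice false) (slice true)) (sym (inside (false ∷ Y) (false ∷ Z) zero refl refl)))

-- Bases

_⊑_ : ∀ {n} → Subset n → Subset n → Set
X ⊑ Z = ∀ i → T (lookup X i) → T (lookup Z i)

⊑-reflects : ∀ {n} (X Z : Subset n) → Reflects (X ⊑ Z) (X ⊆B Z)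
⊑-reflects = andV-zip-reflects λ x z → T-reflects x →-reflects T-reflects z

T-false : ∀ {b} → ¬ T b → b ≡ false
T-false {false} _  = refl
T-false {true}  ¬t = contradiction _ ¬t

⊑-≢-witness : ∀ {n} (X Z : Subset n) → X ⊑ Z → Z ≢ X → ∃ λ i → T (lookup Z i) × lookup X i ≡ false
⊑-≢-witness X Z X⊑Z Z≢X with Fin.any? (λ i → T? (lookup Z i) ×-dec (lookup X i Bool.≟ false))
... | yes w = w
... | no none = contradiction (vec-ext same) Z≢X
  where
  same : ∀ i → lookup Z i ≡ lookup X i
  same i with lookup Z i in eqZ | lookup X i in eqX
  ... | true  | true  = refl
  ... | false | false = refl
  ... | true  | false = contradiction (i , subst T (sym eqZ) _ , eqX) none
  ... | false | true  = contradiction (X⊑Z i (subst T (sym eqX) _)) (subst T eqZ)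

true≢false : true ≢ false
true≢false ()

⊑-≢⇒⊂ : ∀ {n} (X Z : Subset n) → X ⊑ Z → Z ≢ X → X S.⊂ Z
⊑-≢⇒⊂ X Z X⊑Z Z≢X with i , i∈Z , i∉X ← ⊑-≢-witness X Z X⊑Z Z≢X =
  (λ {j} j∈X → lookup⇒[]= j Z (to T-≡ (X⊑Z j (from T-≡ ([]=⇒lookup j∈X))))) ,
  i , lookup⇒[]= i Z (to T-≡ i∈Z) , λ i∈X → true≢false (trans (sym ([]=⇒lookup i∈X)) i∉X)

⊑-insert : ∀ {n} (Z : Subset n) i → Z ⊑ (Z [ i ]≔ true)
⊑-insert Z i j j∈Z with lookup (Z [ i ]≔ true) j in eq
... | true  = _
... | false = subst T (proj₂ (outside-insert Z i j eq)) j∈Z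

Maximal : ∀ {n} → (Subset n → Set) → Subset n → Set
Maximal P X = P X × (∀ Z → P Z × X ⊑ Z → Z ≡ X)

maximal-reflects : ∀ {n} {P : Subset n → Set} {p} → (∀ X → Reflects (P X) (p X)) →
  ∀ X → Reflects (Maximal P X) (maximalB p X)
maximal-reflects r X = r X ×-reflects
  all-reflects ∈-allSubsets λ Z → (r Z ×-reflects ⊑-reflects X Z) →-reflects eqSub-reflects Z X

∃S? : ∀ {n} {P : Subset n → Set} → (∀ X → Dec (P X)) → Dec (∃ P)
∃S? P? = _ because any-reflects ∈-allSubsets (proof ∘ P?)

_≟S_ : ∀ {n} (X Z : Subset n) → Dec (X ≡ Z)
X ≟S Z = eqSub X Z because eqSub-reflects X Z

_⊑?_ : ∀ {n} (X Z : Subset n) → Dec (X ⊑ Z)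
X ⊑? Z = (X ⊆B Z) because ⊑-reflects X Z

-- Passing to strictly larger sets with P must stop, since proper inclusion among subsets of a
-- finite set is well founded upwards.
maximal-above : ∀ {n} {P : Subset n → Set} → (∀ X → Dec (P X)) →
  ∀ X → P X → ∃ λ Z → Maximal P Z × X ⊑ Z
maximal-above {P = P} P? X = go (⊃-wellFounded X)
  where
  go : ∀ {X} → Acc S._⊃_ X → P X → ∃ λ Z → Maximal P Z × X ⊑ Z
  go {X} (acc rec) PX with ∃S? (λ Z → (P? Z ×-dec (X ⊑? Z)) ×-dec ¬? (Z ≟S X))
  ... | no none = X , (PX , λ Z q → decidable-stable (Z ≟S X) (λ Z≢X → none (Z , q , Z≢X))) , λ _ → id
  ... | yes (Z , (PZ , X⊑Z) , Z≢X) with M , max , Z⊑M ← go (rec (⊑-≢⇒⊂ X Z X⊑Z Z≢X)) PZ =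
    M , max , λ i → Z⊑M i ∘ X⊑Z i

-- R plays the role of a space of linear dependencies.
Independent : ∀ {n} → (Vect n → Set) → Subset n → Set
Independent R Z = ∀ v → (R ↾ Z) v → v ≡ 0v

-- Equivalently, for a subspace R, projection to the coordinates outside Z is a bijection on R.
IsBasis : ∀ {n} → (Vect n → Set) → Subset n → Set
IsBasis R Z = Independent R Z × OntoOutside R Z

module _ {n} {R : Vect n → Set} (S : Subspace R) where

  independent? : ∀ Z → Dec (Independent R Z)
  independent? Z = ∀V? λ v → mem? (↾-subspace S Z) v →-dec (v ≟V 0v)

  dependent-witness : ∀ Z → ¬ Independent R Z → ∃ λ v → (R ↾ Z) v × v ≢ 0v
  dependent-witness Z dep with ∃V? (λ v → mem? (↾-subspace S Z) v ×-dec ¬? (v ≟V 0v))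
  ... | yes w = w
  ... | no none = contradiction (λ v m → decidable-stable (v ≟V 0v) (λ v≢0 → none (v , m , v≢0))) dep

  -- It suffices to lift unit vectors. For `i` outside Z, maximality gives a dependency supported in
  -- Z with `i` added; independence of Z makes its entry at `i` nonzero, and scaling it gives the
  -- lift.
  maximal⇒onto : ∀ Z → Maximal (Independent R) Z → OntoOutside R Z
  maximal⇒onto Z (ind , max) = units-span image-subspace units
    where
    Image : Vect n → Set
    Image t = ∃ λ v → R v × (∀ j → lookup Z j ≡ false → lookup v j ≡ lookup t j)
    image-subspace : Subspace Image
    image-subspace .mem? t = ∃V? λ v → mem? S v ×-dec
      Fin.all? (λ j → (lookup Z j Bool.≟ false) →-dec (lookup v j ≟F lookup t j))
    image-subspace .0-mem = 0v , 0-mem S , λ _ _ → refl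
    image-subspace .⊕-closed {s} {t} (u , u∈R , hu) (v , v∈R , hv) = u ⊕ v , ⊕-closed S u∈R v∈R ,
      λ j out → trans (lookup-⊕ j u v) (trans (cong₂ _+F_ (hu j out) (hv j out)) (sym (lookup-⊕ j s t)))
    image-subspace .⊙-closed a {t} (v , v∈R , hv) = a ⊙ v , ⊙-closed S a v∈R ,
      λ j out → trans (lookup-⊙ j a v) (trans (cong (a *F_) (hv j out)) (sym (lookup-⊙ j a t)))
    insert-dependent : ∀ i → lookup Z i ≡ false → ¬ Independent R (Z [ i ]≔ true)
    insert-dependent i i∉Z ind⁺ = true≢false (trans (sym (lookup∘update i Z true))
      (trans (cong (λ X → lookup X i) (max (Z [ i ]≔ true) (ind⁺ , ⊑-insert Z i))) i∉Z))
    units : ∀ i → Image (unit i)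
    units i with lookup Z i in eqZ
    -- For `i` in Z the unit vector vanishes outside Z, so zero is a lift.
    ... | true = 0v , 0-mem S , λ j out → trans (lookup-0v j)
      (sym (lookup-unit-≢ {i = i} {j} λ { refl → contradiction (trans (sym eqZ) out) λ () }))
    ... | false with v , (v∈R , supp) , v≢0 ← dependent-witness (Z [ i ]≔ true) (insert-dependent i eqZ) =
      invF (lookup v i) ⊙ v , ⊙-closed S (invF (lookup v i)) v∈R , matches
      where
      vᵢ≢O : lookup v i ≢ O
      vᵢ≢O vᵢ≡O = v≢0 (ind v (v∈R , supported-remove Z i v supp vᵢ≡O))
      matches : ∀ j → lookup Z j ≡ false → lookup (invF (lookup v i) ⊙ v) j ≡ lookup (unit i) j
      matches j out with outside-cases Z i j out
      ... | inj₁ refl = trans (normalise i v vᵢ≢O) (sym (lookup-unit i))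
      ... | inj₂ out⁺ = trans (lookup-⊙ j (invF (lookup v i)) v) (trans (cong (invF (lookup v i) *F_) (supp j out⁺))
              (trans (*F-zeroʳ (invF (lookup v i))) (sym (lookup-unit-≢ (proj₁ (outside-insert Z i j out⁺))))))

  -- For the converse, a larger independent X would contain some `i` outside Z, and the lift of
  -- `unit i` would be a nonzero dependency supported in X.
  maximal-independent⇔basis : ∀ Z → Maximal (Independent R) Z ⇔ IsBasis R Z
  maximal-independent⇔basis Z = mk⇔ (λ m → proj₁ m , maximal⇒onto Z m) basis⇒maximal
    where
    basis⇒maximal : IsBasis R Z → Maximal (Independent R) Z
    basis⇒maximal (ind , onto) = ind , λ X (indX , Z⊑X) → decidable-stable (X ≟S Z) λ X≢Z →
      let i , i∈X , i∉Z = ⊑-≢-witness Z X Z⊑X X≢Z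
          v , (v∈R , supp) , vᵢ≡I = onto-pivot S Z i i∉Z onto
          suppX = λ j out → supp j (avoid X i i∈X Z⊑X j out)
      in I≢O (trans (sym vᵢ≡I) (trans (cong (λ w → lookup w i) (indX v (v∈R , suppX))) (lookup-0v i)))
      where
      avoid : ∀ X i → T (lookup X i) → Z ⊑ X → ∀ j → lookup X j ≡ false → lookup (Z [ i ]≔ true) j ≡ false
      avoid X i i∈X Z⊑X j out with outside-cases Z i j (T-false {lookup Z j} λ j∈Z → subst T out (Z⊑X j j∈Z))
      ... | inj₁ refl = ⊥-elim (subst T out i∈X)
      ... | inj₂ out⁺ = out⁺

-- Bases of the radical and maximal admissible sets

module _ {n} {L : Vect n → Set} (S : Subspace L) (Y : Subset n) where

  admissible⇒independent : ∀ Z → Admissible L Y Z → Independent (Radical L Y) Z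
  admissible⇒independent Z (_ , nondeg) v ((v∈L , v-rad) , supp) =
    nondeg v ((v∈L , supp) , λ u (u∈L , _) → v-rad u u∈L)

  basis⇒admissible : ∀ Z → IsBasis (Radical L Y) Z → Admissible L Y Z
  basis⇒admissible Z (ind , onto) = (λ t → let v , (v∈L , _) , h = onto t in v , v∈L , h) ,
    λ v ((v∈L , supp) , v-rad) → ind v ((v∈L , λ u u∈L → orthogonal v v∈L v-rad u u∈L) , supp)
    where
    orthogonal : ∀ v → L v → (∀ u → (L ↾ Z) u → herm Y u v ≡ O) → ∀ u → L u → herm Y u v ≡ O
    -- Some `r` in the radical agrees with `u` outside Z. Then `u ⊕ r` is supported in Z and pairs
    -- to zero with `v`, as does `r`.
    orthogonal v v∈L v-rad u u∈L with r , (r∈L , r-rad) , h ← onto u =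
      trans (+F-cancel _ _ (trans (sym (dot-⊕ˡ u r _)) (v-rad (u ⊕ r)
          (⊕-closed S u∈L r∈L , λ j out → trans (lookup-⊕ j u r)
            (trans (cong (lookup u j +F_) (h j out)) (+F-self (lookup u j)))))))
        (herm-vanish-sym Y v r (r-rad v v∈L))

  -- Maximal independent sets are admissible, and admissible sets are independent. So a maximal
  -- admissible Z equals any maximal independent set above it.
  maximal-independent⇔maximal-admissible : ∀ Z →
    Maximal (Independent (Radical L Y)) Z ⇔ Maximal (Admissible L Y) Z
  maximal-independent⇔maximal-admissible Z = mk⇔
    (λ max → maximal⇒admissible Z max , λ X (adm , Z⊑X) → proj₂ max X (admissible⇒independent X adm , Z⊑X))
    λ (adm , max) → let X , maxX , Z⊑X = maximal-above (independent? (radical-subspace S Y)) Z (admissible⇒independent Z adm)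
                    in subst (Maximal (Independent (Radical L Y))) (max X (maximal⇒admissible X maxX , Z⊑X)) maxX
    where
    maximal⇒admissible : ∀ X → Maximal (Independent (Radical L Y)) X → Admissible L Y X
    maximal⇒admissible X = basis⇒admissible X ∘ to (maximal-independent⇔basis (radical-subspace S Y) X)

-- The matroids of the statement

Ker : ∀ {m n} → Matrix m n → Vect n → Set
Ker B v = ∀ r → dot (lookup B r) v ≡ O

ker-reflects : ∀ {m n} (B : Matrix m n) v → Reflects (Ker B v) (ker B v)
ker-reflects B v = andV-reflects (λ row → =F-reflects (dot row v) O) B

ker-subspace : ∀ {m n} (B : Matrix m n) → Subspace (Ker B)
ker-subspace B .mem? v = ker B v because ker-reflects B v
ker-subspace B .0-mem r = dot-0ʳ (lookup B r)
ker-subspace B .⊕-closed {u} {v} hu hv r =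
  trans (dot-⊕ʳ (lookup B r) u v) (cong₂ _+F_ (hu r) (hv r))
ker-subspace B .⊙-closed a {v} hv r =
  trans (dot-⊙ʳ a (lookup B r) v) (trans (cong (a *F_) (hv r)) (*F-zeroʳ a))

support-T : ∀ {n} (v : Vect n) i → T (lookup (support v) i) ⇔ (lookup v i ≢ O)
support-T v i rewrite lookup-map i (λ x → not (isZeroF x)) v =
  mk⇔ (reflects-to (¬-reflects (=F-reflects (lookup v i) O)))
      (reflects-from (¬-reflects (=F-reflects (lookup v i) O)))

support-⊑ : ∀ {n} (Z : Subset n) v → (support v ⊑ Z) ⇔ SupportedIn Z v
support-⊑ Z v = mk⇔
  (λ h i out → decidable-stable (lookup v i ≟F O) λ vᵢ≢O → subst T out (h i (from (support-T v i) vᵢ≢O)))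
  (λ h i i∈v → decidable-stable (T? (lookup Z i)) λ i∉Z → to (support-T v i) i∈v (h i (T-false i∉Z)))

indepCol-reflects : ∀ {m n} (B : Matrix m n) Z → Reflects (Independent (Ker B) Z) (indepCol B Z)
indepCol-reflects B Z = all-reflects ∈-allVects λ c →
  reflects-map (mk⇔ (λ (s , k) → k , to (support-⊑ Z c) s) (λ (k , s) → from (support-⊑ Z c) s , k))
    (⊑-reflects (support c) Z ×-reflects ker-reflects B c)
  →-reflects reflects-map
    (mk⇔ (λ h → vec-ext λ i → trans (h i) (sym (lookup-0v i))) (λ { refl i → lookup-0v i }))
    (andV-reflects (λ x → =F-reflects x O) c)

basesCol-reflects : ∀ {m n} (B : Matrix m n) Z → Reflects (IsBasis (Ker B) Z) (basesCol B Z)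
basesCol-reflects B Z = reflects-map (maximal-independent⇔basis (ker-subspace B) Z)
  (maximal-reflects (indepCol-reflects B) Z)

invV-involutive : ∀ {n} (v : Vect n) → invV (invV v) ≡ v
invV-involutive []      = refl
invV-involutive (x ∷ v) = cong₂ _∷_ (invF-involutive x) (invV-involutive v)

-- As `invV` is an involution, the witness in `invS` can only be `invV (proj Y v)`, and its
-- annihilating L is the radical condition.
BC-reflects : ∀ {n} {L : Vect n → Set} {l} → (∀ v → Reflects (L v) (l v)) →
  ∀ Y v → Reflects (Radical L Y v) (BC l Y v)
BC-reflects {L = L} r Y v = r v ×-reflects reflects-map
  (mk⇔ (λ (s , s⊥ , eq) u u∈L →
          trans (cong (dot u) (trans (cong invV (sym eq)) (invV-involutive s))) (s⊥ u u∈L))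
       (λ h → invV (proj Y v) , h , invV-involutive (proj Y v)))
  (any-reflects ∈-allVects λ s →
    all-reflects ∈-allVects (λ u → r u →-reflects =F-reflects (dot u s) O)
    ×-reflects eqVect-reflects (invV s) (proj Y v))

-- Circuits and independence in M(R)

Nonempty : ∀ {n} → Subset n → Set
Nonempty X = ∃ λ i → T (lookup X i)

nonempty-reflects : ∀ {n} (X : Subset n) → Reflects (Nonempty X) (nonempty X)
nonempty-reflects []          = ofⁿ λ ()
nonempty-reflects (true ∷ X)  = ofʸ (zero , _)
nonempty-reflects (false ∷ X) = reflects-map
  (mk⇔ (λ (i , t) → suc i , t) (λ { (suc i , t) → i , t })) (nonempty-reflects X)

module _ {n} {R : Vect n → Set} {r : VSet n} (R-reflects : ∀ v → Reflects (R v) (r v)) where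

  IsSupport : Subset n → Set
  IsSupport C = ∃ λ v → R v × support v ≡ C

  isSupport-reflects : ∀ C → Reflects (IsSupport C) (isSupportIn r C)
  isSupport-reflects C = any-reflects ∈-allVects λ v → R-reflects v ×-reflects eqSub-reflects (support v) C

  Smaller : Subset n → Subset n → Set
  Smaller C C′ = Nonempty C′ × C′ ⊑ C × C′ ≢ C × IsSupport C′

  smaller-reflects : ∀ C → Reflects (∃ (Smaller C)) _
  smaller-reflects C = any-reflects ∈-allSubsets λ C′ → nonempty-reflects C′ ×-reflects
    ⊑-reflects C′ C ×-reflects ¬-reflects (eqSub-reflects C′ C) ×-reflects isSupport-reflects C′

  Circuit : Subset n → Set
  Circuit C = Nonempty C × IsSupport C × ¬ ∃ (Smaller C)

  circuit-reflects : ∀ C → Reflects (Circuit C) (circuitML r C)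
  circuit-reflects C = nonempty-reflects C ×-reflects isSupport-reflects C ×-reflects ¬-reflects (smaller-reflects C)

  -- Descent through smaller nonempty supports until none is left.
  circuit-below : ∀ {C} → Acc S._⊂_ C → Nonempty C → IsSupport C → ∃ λ C′ → Circuit C′ × C′ ⊑ C
  circuit-below {C} (acc rec) ne supp with _ because smaller-reflects C
  ... | no none = C , (ne , supp , none) , λ _ → id
  ... | yes (D , neD , D⊑C , D≢C , suppD)
    with C′ , circ , C′⊑D ← circuit-below (rec (⊑-≢⇒⊂ D C D⊑C (D≢C ∘ sym))) neD suppD =
    C′ , circ , λ i → D⊑C i ∘ C′⊑D i

  -- The support of a nonzero vector of R contains a circuit, and a circuit is itself the support of
  -- a nonzero vector of R.
  indepML-reflects : ∀ X → Reflects (Independent R X) (indepML r X)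
  indepML-reflects X = reflects-map (mk⇔ circuit-free⇒independent independent⇒circuit-free)
    (¬-reflects (any-reflects ∈-allSubsets λ C → circuit-reflects C ×-reflects ⊑-reflects C X))
    where
    circuit-free⇒independent : ¬ (∃ λ C → Circuit C × C ⊑ X) → Independent R X
    circuit-free⇒independent none v (v∈R , supp) = vec-ext λ i →
      trans (decidable-stable (lookup v i ≟F O) (λ vᵢ≢O →
        let C , circ , C⊑v = circuit-below (⊂-wellFounded (support v)) (i , from (support-T v i) vᵢ≢O) (v , v∈R , refl)
        in none (C , circ , λ j → from (support-⊑ X v) supp j ∘ C⊑v j)))
      (sym (lookup-0v i))
    independent⇒circuit-free : Independent R X → ¬ (∃ λ C → Circuit C × C ⊑ X)
    independent⇒circuit-free ind (_ , ((i , i∈v) , (v , v∈R , refl) , _) , v⊑X) =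
      to (support-T v i) i∈v
        (trans (cong (λ w → lookup w i) (ind v (v∈R , to (support-⊑ X v) v⊑X))) (lookup-0v i))

-- Admissibility obeys both rules of `loopCompl-unique`. At the empty Y the form is zero, so
-- nondegeneracy says that L ↾ Z is trivial and the admissible sets are the bases of M.
loopCompl-reflects : ∀ {m n} (B : Matrix m n) Y Z →
  Reflects (Admissible (Ker B) Y Z) (loopCompl (basesCol B) Y Z)
loopCompl-reflects {n = n} B Y Z = subst (Reflects (Admissible L Y Z)) (sym parity) (proof (admissible? S Y Z))
  where
  L : Vect n → Set
  L = Ker B
  S : Subspace L
  S = ker-subspace B
  N : Subset n → SetSystem n
  N Y Z = does (admissible? S Y Z)
  basis⇔admissible-∅ : ∀ Z → IsBasis L Z ⇔ Admissible L (replicate n false) Z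
  basis⇔admissible-∅ Z = mk⇔
    (λ (ind , onto) → onto , λ v (m , _) → ind v m)
    (λ (onto , nondeg) → (λ v m → nondeg v (m , λ u _ → herm-∅ u v)) , onto)
  parity : loopCompl (basesCol B) Y Z ≡ N Y Z
  parity = trans
    (loopCompl-cong (λ X → det (reflects-map (basis⇔admissible-∅ X) (basesCol-reflects B X))
                               (proof (admissible? S (replicate n false) X))) Y Z)
    (loopCompl-unique N
      (λ Y Z i i∉Y i∉Z → det (proof (admissible? S (Y [ i ]≔ true) Z))
        (reflects-map (admissible-outside S Y Z i i∉Y i∉Z) (proof (admissible? S Y Z))))
      (λ Y Z i i∉Y i∉Z → admissible-inside S Z i i∉Z Y i∉Y (proof (admissible? S (Y [ i ]≔ true) (Z [ i ]≔ true)))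
        (proof (admissible? S Y Z)) (proof (admissible? S Y (Z [ i ]≔ true))))
      Y Z)

theorem3 : (m n : ℕ) (B : Matrix m n) (Y : Subset n) (Z : Subset n) →
    basesML (BC (ker B) Y) Z ≡ maxSS (loopCompl (basesCol B) Y) Z
theorem3 m n B Y Z = det
  (reflects-map (maximal-independent⇔maximal-admissible (ker-subspace B) Y Z)
    (maximal-reflects (indepML-reflects (BC-reflects (ker-reflects B) Y)) Z))
  (maximal-reflects (loopCompl-reflects B Y) Z)
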